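{- Stuttering bisimilarity is incomparable to each of: governed bisimilarity, strong direct simulation equivalence, direct simulation equivalence, delayed simulation equivalence, even-biased delayed simulation equivalence and odd-biased delayed simulation equivalence. That is, for each relation $\approx$ in this list, there is a parity game with vertices $v,w$ that are stuttering bisimilar but do not satisfy $v\approx w$, and there is a parity game with vertices $v,w$ that satisfy $v\approx w$ but are not stuttering bisimilar.
   Context: A parity game is a tuple $(V,\to,\Omega,\mathcal P)$ where $V$ is a finite set of vertices, $\to\subseteq V\times V$ is total (every vertex has at least one successor), $\Omega:V\to\mathbb N$ is a priority function, and $\mathcal P:V\to\{\Diamond,\Box\}$ assigns each vertex to player even ($\Diamond$) or odd ($\Box$). Write $V_\Diamond,V_\Box$ for the vertices owned by each player and $v^\bullet=\{w\mid v\to w\}$. Stuttering bisimilarity: a memoryless strategy for player $i$ is a partial function $\sigma:V\to V$ defined only on vertices owned by $i$, with $v\to\sigma(v)$ whenever defined; it allows an infinite path $v_0v_1\dots$ iff $v_{j+1}=\sigma(v_j)$ whenever $\sigma(v_j)$ is defined. $v\mapsto_{i,U}T$ iff there is a memoryless strategy $\sigma$ for $i$ such that every infinite path $v_0v_1\dots$ with $v_0=v$ allowed by $\sigma$ has some $n$ with $v_n\in T$ and $v_j\in U$ for all $j<n$. $v\mapsto_{i,U}$ iff there is such $\sigma$ for which every infinite path from $v$ allowed by $\sigma$ stays in $U$ forever. An equivalence relation $R$ on $V$ is a governed stuttering bisimulation iff $v\,R\,w$ implies: (a) $\Omega(v)=\Omega(w)$; (b) for all $R$-classes $\mathcal C\neq[v]_R$,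 if $v$ has a successor in $\mathcal C$ then $w\mapsto_{\mathcal P(v),[w]_R}\mathcal C$; (c) for each player $i$, $v\mapsto_{i,[v]_R}$ implies $w\mapsto_{i,[w]_R}$. A stuttering bisimulation is a governed stuttering bisimulation that only relates vertices with the same owner; vertices are stuttering bisimilar iff some stuttering bisimulation relates them. Governed bisimilarity: a symmetric $R\subseteq V\times V$ is a governed bisimulation iff $v\,R\,w$ implies: (1) $\Omega(v)=\Omega(w)$; (2) if $\mathcal P(v)\neq\mathcal P(w)$, then $v'\,R\,w'$ for all $v'\in v^\bullet$, $w'\in w^\bullet$; (3) for all $v'\in v^\bullet$ there is $w'\in w^\bullet$ with $v'\,R\,w'$. Vertices are governed bisimilar iff some governed bisimulation relates them. (Strong) direct simulation equivalence: $v\to_i T$ (one-step forcing) means: either $\mathcal P(v)=i$ and $v^\bullet\cap T\neq\emptyset$, or $\mathcal P(v)\neq i$ and $v^\bullet\subseteq T$. Put $vR=\{w\mid v\,R\,w\}$, $UR=\bigcup_{u\in U}uR$. $R\subseteq V\times V$ is a direct simulation iff $v\,R\,w$ implies $\Omega(v)=\Omega(w)$; if $v\in V_\Diamond$ then $w\to_\Diamond v'R$ for each $v'\in v^\bullet$; if $v\in V_\Box$ then $w\to_\Diamond v^\bullet R$. A strong direct simulation is a direct simulation that only relates vertices with the same owner. $v,w$ are (strong) direct simulation equivalent iff some (strong) direct simulation relates $v$ to $w$ and some (strong) direct simulation relates $w$ to $v$. Delayed simulation equivalences: reward order: $n\preccurlyeq m$ iff $n$ is even and $m$ is odd; or both are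 even and $n\le m$; or both are odd and $m\le n$. Obligations: $K=\mathbb N\cup\{\checkmark\}$. Update $\gamma:\mathbb N\times\mathbb N\times K\to K$: $\gamma(n,m,\checkmark)=\checkmark$ if $m\preccurlyeq n$, else $\min\{n,m\}$; for $k\in\mathbb N$, $\gamma(n,m,k)=\checkmark$ if $m\preccurlyeq n$ and ($n$ odd and $n\le k$, or $m$ even and $m\le k$), else $\min\{n,m,k\}$ (usual order for $\min$). Even-biased update $\gamma^e$: for $k\in\mathbb N$, $\gamma^e(n,m,k)=k$ if $m\preccurlyeq n$, $n$ is odd, $n\le k$ and ($m$ is odd or $k<m$); $\gamma^e=\gamma$ otherwise. Odd-biased update $\gamma^o$: for $k\in\mathbb N$, $\gamma^o(n,m,k)=k$ if $m\preccurlyeq n$, $m$ is even, $m\le k$ and ($n$ is even or $k<n$); $\gamma^o=\gamma$ otherwise. For $k=\checkmark$ both equal $\gamma(n,m,\checkmark)$. For $\delta\in\{\gamma,\gamma^e,\gamma^o\}$, $\delta(v,w,k)$ abbreviates $\delta(\Omega(v),\Omega(w),k)$, and the $\delta$-game is played by Spoiler and Duplicator in rounds on positions $(v,w)\in V\times V$ with an obligation $k\in K$: $v'\in v^\bullet$, $w'\in w^\bullet$ are chosen as follows: if $\mathcal P(v)=\mathcal P(w)=\Diamond$, Spoiler chooses $v'$, then Duplicator $w'$; if $\mathcal P(v)=\Diamond,\mathcal P(w)=\Box$, Spoiler chooses $v'$, then Spoiler $w'$; if $\mathcal P(v)=\Box,\mathcal P(w)=\Diamond$, Duplicator chooses $w'$,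 then Duplicator $v'$; if $\mathcal P(v)=\mathcal P(w)=\Box$, Spoiler chooses $w'$, then Duplicator $v'$. Play continues from $(v',w')$ with obligation $\delta(v',w',k)$. Duplicator wins an infinite play iff the obligation is $\checkmark$ infinitely often; otherwise Spoiler wins. $v$ is simulated by $w$ iff Duplicator has a winning strategy from $(v,w)$ with obligation $\delta(v,w,\checkmark)$, and $v,w$ are equivalent iff each is simulated by the other. For $\delta=\gamma,\gamma^e,\gamma^o$ this gives delayed, even-biased delayed, and odd-biased delayed simulation equivalence. -}

module Defs where

open import Data.Bool.Base using (if_then_else_)
open import Data.Fin.Base using (Fin)
open import Data.Fin.Subset using (Subset; Nonempty; _∈_)
open import Data.List.Base using (List; applyDownFrom)
open import Data.Maybe.Base using (Maybe; just)
open import Data.Nat.Base using (ℕ; suc; _≤_; _<_; _⊓_; parity)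
open import Data.Nat.Properties using (_≤?_; _<?_)
open import Data.Parity.Base using (0ℙ; 1ℙ)
open import Data.Parity.Properties using (_≟_)
open import Data.Product.Base using (_×_; _,_; ∃; ∃-syntax; proj₁)
open import Data.Sum.Base using (_⊎_)
open import Data.Unit.Base using (⊤)
open import Level using (Level; 0ℓ; _⊔_) renaming (suc to lsuc)
open import Relation.Binary.Core using (Rel)
open import Relation.Binary.Definitions using (Symmetric)
open import Relation.Binary.PropositionalEquality.Core using (_≡_; _≢_)
open import Relation.Binary.Structures using (IsEquivalence)
open import Relation.Nullary.Decidable using (Dec; ⌊_⌋; _×-dec_; _⊎-dec_)
open import Relation.Nullary.Negation.Core using (¬_)
open import Relation.Unary using (Pred; _≐_)

data Player : Set where
  ◇ □ : Player

record ParityGame : Set where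
  field
    size  : ℕ
    _•    : Fin size → Subset size
    total : ∀ v → Nonempty (v •)
    Ω     : Fin size → ℕ
    𝒫     : Fin size → Player

  Vertex : Set
  Vertex = Fin size

  infix 4 _⟶_
  _⟶_ : Rel Vertex 0ℓ
  v ⟶ w = w ∈ v •

  Successor : Vertex → Set
  Successor v = ∃[ w ] v ⟶ w

GameRel : (ℓ : Level) → Set (lsuc ℓ)
GameRel ℓ = (G : ParityGame) → Rel (ParityGame.Vertex G) ℓ

Incomparable : ∀ {a b} → GameRel a → GameRel b → Set (a ⊔ b)
Incomparable _∼_ _≈_ =
    (∃[ G ] ∃[ v ] ∃[ w ] (_∼_ G v w × ¬ _≈_ G v w))
  × (∃[ G ] ∃[ v ] ∃[ w ] (_≈_ G v w × ¬ _∼_ G v w))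

Even Odd : ℕ → Set
Even n = parity n ≡ 0ℙ
Odd  n = parity n ≡ 1ℙ

even? : ∀ n → Dec (Even n)
even? n = parity n ≟ 0ℙ

odd? : ∀ n → Dec (Odd n)
odd? n = parity n ≟ 1ℙ

infix 4 _≼_ _≼?_

_≼_ : Rel ℕ 0ℓ
n ≼ m = (Even n × Odd m) ⊎ (Even n × Even m × n ≤ m) ⊎ (Odd n × Odd m × m ≤ n)

_≼?_ : ∀ n m → Dec (n ≼ m)
n ≼? m = (even? n ×-dec odd? m)
  ⊎-dec ((even? n ×-dec (even? m ×-dec (n ≤? m)))
  ⊎-dec (odd? n ×-dec (odd? m ×-dec (m ≤? n))))

data Obligation : Set where
  ✓       : Obligation
  pending : ℕ → Obligation

Update : Set
Update = ℕ → ℕ → Obligation → Obligation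

γ : Update
γ n m ✓ = if ⌊ m ≼? n ⌋ then ✓ else pending (n ⊓ m)
γ n m (pending k) =
  if ⌊ (m ≼? n) ×-dec ((odd? n ×-dec (n ≤? k)) ⊎-dec (even? m ×-dec (m ≤? k))) ⌋
  then ✓
  else pending (n ⊓ m ⊓ k)

γᵉ : Update
γᵉ n m ✓ = γ n m ✓
γᵉ n m (pending k) =
  if ⌊ (m ≼? n) ×-dec (odd? n ×-dec ((n ≤? k) ×-dec (odd? m ⊎-dec (k <? m)))) ⌋
  then pending k
  else γ n m (pending k)

γᵒ : Update
γᵒ n m ✓ = γ n m ✓
γᵒ n m (pending k) =
  if ⌊ (m ≼? n) ×-dec (even? m ×-dec ((m ≤? k) ×-dec (even? n ⊎-dec (k <? n)))) ⌋
  then pending k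
  else γ n m (pending k)

module _ (G : ParityGame) where
  open ParityGame G

  IsPath : (ℕ → Vertex) → Set
  IsPath π = ∀ j → π j ⟶ π (suc j)

  record MemorylessStrategy (i : Player) : Set where
    field
      choice : Vertex → Maybe Vertex
      owned  : ∀ {u u′} → choice u ≡ just u′ → 𝒫 u ≡ i
      legal  : ∀ {u u′} → choice u ≡ just u′ → u ⟶ u′

    Allows : (ℕ → Vertex) → Set
    Allows π = ∀ j {u} → choice (π j) ≡ just u → π (suc j) ≡ u

  open MemorylessStrategy using (Allows)

  ForcesTo : Player → Pred Vertex 0ℓ → Vertex → Pred Vertex 0ℓ → Set
  ForcesTo i U v T = ∃[ σ ] ∀ π → IsPath π → π 0 ≡ v → Allows {i} σ π →
    ∃[ n ] (T (π n) × (∀ j → j < n → U (π j)))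

  ForcesWithin : Player → Pred Vertex 0ℓ → Vertex → Set
  ForcesWithin i U v = ∃[ σ ] ∀ π → IsPath π → π 0 ≡ v → Allows {i} σ π →
    ∀ j → U (π j)

  SameOwner : Rel Vertex 0ℓ → Set
  SameOwner R = ∀ {v w} → R v w → 𝒫 v ≡ 𝒫 w

  -- The class of u under the equivalence R is the predicate R u.
  record IsGovernedStutteringBisimulation (R : Rel Vertex 0ℓ) : Set where
    field
      isEquivalence : IsEquivalence R
      priority : ∀ {v w} → R v w → Ω v ≡ Ω w
      transfer : ∀ {v w} → R v w → ∀ u → ¬ (R u ≐ R v) →
                 (∃[ v′ ] (v ⟶ v′ × R u v′)) → ForcesTo (𝒫 v) (R w) w (R u)
      diverge  : ∀ {v w} → R v w → ∀ i →
                 ForcesWithin i (R v) v → ForcesWithin i (R w) w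

  record IsStutteringBisimulation (R : Rel Vertex 0ℓ) : Set where
    field
      isGoverned : IsGovernedStutteringBisimulation R
      sameOwner  : SameOwner R

  StutteringBisimilar : Rel Vertex (lsuc 0ℓ)
  StutteringBisimilar v w = ∃[ R ] (IsStutteringBisimulation R × R v w)

  record IsGovernedBisimulation (R : Rel Vertex 0ℓ) : Set where
    field
      symmetric : Symmetric R
      priority  : ∀ {v w} → R v w → Ω v ≡ Ω w
      mixed     : ∀ {v w} → R v w → 𝒫 v ≢ 𝒫 w →
                  ∀ {v′ w′} → v ⟶ v′ → w ⟶ w′ → R v′ w′
      transfer  : ∀ {v w} → R v w → ∀ {v′} → v ⟶ v′ → ∃[ w′ ] (w ⟶ w′ × R v′ w′)

  GovernedBisimilar : Rel Vertex (lsuc 0ℓ)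
  GovernedBisimilar v w = ∃[ R ] (IsGovernedBisimulation R × R v w)

  OneStepForces : Player → Vertex → Pred Vertex 0ℓ → Set
  OneStepForces i v T =
      (𝒫 v ≡ i × (∃[ u ] (v ⟶ u × T u)))
    ⊎ (𝒫 v ≢ i × (∀ {u} → v ⟶ u → T u))

  Image : Pred Vertex 0ℓ → Rel Vertex 0ℓ → Pred Vertex 0ℓ
  Image U R w = ∃[ u ] (U u × R u w)

  record IsDirectSimulation (R : Rel Vertex 0ℓ) : Set where
    field
      priority : ∀ {v w} → R v w → Ω v ≡ Ω w
      even     : ∀ {v w} → R v w → 𝒫 v ≡ ◇ → ∀ {v′} → v ⟶ v′ → OneStepForces ◇ w (R v′)
      odd      : ∀ {v w} → R v w → 𝒫 v ≡ □ → OneStepForces ◇ w (Image (v ⟶_) R)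

  record IsStrongDirectSimulation (R : Rel Vertex 0ℓ) : Set where
    field
      isDirect  : IsDirectSimulation R
      sameOwner : SameOwner R

  DirectSimulationEquivalent : Rel Vertex (lsuc 0ℓ)
  DirectSimulationEquivalent v w =
      (∃[ R ] (IsDirectSimulation R × R v w))
    × (∃[ R ] (IsDirectSimulation R × R w v))

  StrongDirectSimulationEquivalent : Rel Vertex (lsuc 0ℓ)
  StrongDirectSimulationEquivalent v w =
      (∃[ R ] (IsStrongDirectSimulation R × R v w))
    × (∃[ R ] (IsStrongDirectSimulation R × R w v))

  Position : Set
  Position = Vertex × Vertex × Obligation

  -- Duplicator's part in a single round from (v , w), given the owners of v
  -- and w; an argument is a choice Spoiler makes before Duplicator has to move.
  Reply : (pv pw : Player) (v w : Vertex) → Set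
  Reply ◇ ◇ v w = Successor v → Successor w
  Reply ◇ □ v w = ⊤
  Reply □ ◇ v w = Successor w × Successor v
  Reply □ □ v w = Successor w → Successor v

  Agrees : ∀ pv pw {v w} → Reply pv pw v w → Successor v → Successor w → Set
  Agrees ◇ ◇ r         v′ w′ = proj₁ w′ ≡ proj₁ (r v′)
  Agrees ◇ □ _         v′ w′ = ⊤
  Agrees □ ◇ (rʷ , rᵛ) v′ w′ = proj₁ w′ ≡ proj₁ rʷ × proj₁ v′ ≡ proj₁ rᵛ
  Agrees □ □ r         v′ w′ = proj₁ v′ ≡ proj₁ (r w′)

  -- The list holds the earlier positions of the play, most recent first.
  DuplicatorStrategy : Set
  DuplicatorStrategy =
    List Position → ((v , w , _) : Position) → Reply (𝒫 v) (𝒫 w) v w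

  module _ (δ : Update) where

    Round : ((v , w , _) : Position) → Reply (𝒫 v) (𝒫 w) v w → Position → Set
    Round (v , w , k) r (v′ , w′ , k′) =
      (∃[ e ] ∃[ f ] Agrees (𝒫 v) (𝒫 w) r (v′ , e) (w′ , f)) × k′ ≡ δ (Ω v′) (Ω w′) k

    ConsistentWith : DuplicatorStrategy → (ℕ → Position) → Set
    ConsistentWith σ ρ =
      ∀ n → Round (ρ n) (σ (applyDownFrom ρ n) (ρ n)) (ρ (suc n))

    DuplicatorWins : (ℕ → Position) → Set
    DuplicatorWins ρ = ∀ n → ∃[ m ] (n ≤ m × (∃[ v ] ∃[ w ] ρ m ≡ (v , w , ✓)))

    SimulatedBy : Rel Vertex 0ℓ
    SimulatedBy v w = ∃[ σ ] ∀ ρ → ρ 0 ≡ (v , w , δ (Ω v) (Ω w) ✓) →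
      ConsistentWith σ ρ → DuplicatorWins ρ

    SimulationEquivalent : Rel Vertex 0ℓ
    SimulationEquivalent v w = SimulatedBy v w × SimulatedBy w v

DelayedSimulationEquivalent : GameRel 0ℓ
DelayedSimulationEquivalent G = SimulationEquivalent G γ

EvenBiasedDelayedSimulationEquivalent : GameRel 0ℓ
EvenBiasedDelayedSimulationEquivalent G = SimulationEquivalent G γᵉ

OddBiasedDelayedSimulationEquivalent : GameRel 0ℓ
OddBiasedDelayedSimulationEquivalent G = SimulationEquivalent G γᵒ

{-# OPTIONS --safe #-}

-- Three games suffice. In 0 → 1 → 2 → 2 with priorities 0, 0, 1 the vertices 0 and 1 are
-- stuttering bisimilar, but all the other relations compare plays in lockstep, and so end up
-- comparing 1 with 2. Conversely, two vertices with different owners and equal priority and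
-- successors are never stuttering bisimilar, but only strong direct simulation equivalence can
-- also tell them apart. For that relation, the witness is a pair of similar vertices that are
-- not bisimilar, one of them having an extra move to a vertex that is simulated by, but not
-- stuttering bisimilar to, one of their common successors.
module Submission where

open import Defs
open import Data.Empty using (⊥-elim)
open import Data.Fin.Base using (Fin; zero; suc)
open import Data.Fin.Patterns using (0F; 1F; 2F; 3F)
open import Data.Fin.Subset using (Subset; inside; outside; ⁅_⁆)
open import Data.Fin.Subset.Properties using (x∈⁅x⁆; x∈⁅y⁆⇒x≡y)
open import Data.List.Base using (applyDownFrom)
open import Data.Maybe.Base using (just; nothing; fromMaybe)
open import Data.Nat.Base using (ℕ; zero; suc; _≤_; _<_; s≤s)
open import Data.Nat.Properties using (≤-refl)
open import Data.Product.Base using (_×_; _,_; ∃-syntax; proj₁; proj₂; map₂)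
open import Data.Sum.Base using (inj₁; inj₂)
open import Data.Unit.Base using (⊤; tt)
open import Data.Vec.Base using ([]; _∷_; here; there)
open import Level using (0ℓ)
open import Relation.Binary.Core using (Rel)
open import Relation.Binary.PropositionalEquality
  using (_≡_; refl; sym; trans; cong; cong₂; subst)
open import Relation.Binary.Structures using (IsEquivalence)
open import Relation.Nullary.Negation.Core using (¬_)
open import Relation.Unary using (_≐_)

-- Tools for arbitrary games: allowed paths, one-step forcing, constant priorities.

module _ (G : ParityGame) where
  open ParityGame G

  -- Forcing speaks of all allowed paths, so refuting it takes an actual path. Where the strategy is
  -- undefined, totality supplies a move.
  allowedPath : ∀ {i} (σ : MemorylessStrategy G i) v →
    ∃[ π ] (IsPath G π × π 0 ≡ v × MemorylessStrategy.Allows σ π)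
  allowedPath σ v = π , path , refl , allows
    where
    open MemorylessStrategy σ

    next : Vertex → Vertex
    next u = fromMaybe (proj₁ (total u)) (choice u)

    π : ℕ → Vertex
    π zero    = v
    π (suc j) = next (π j)

    next-legal : ∀ u → u ⟶ next u
    next-legal u with choice u in eq
    ... | just _  = legal eq
    ... | nothing = proj₂ (total u)

    path : IsPath G π
    path j = next-legal (π j)

    allows : Allows π
    allows j eq = cong (fromMaybe _) eq

  path-invariant : (P : Vertex → Set) → (∀ {u u′} → P u → u ⟶ u′ → P u′) →
    ∀ {π} → IsPath G π → P (π 0) → ∀ j → P (π j)
  path-invariant P closed path p zero    = p
  path-invariant P closed path p (suc j) =
    closed (path-invariant P closed path p j) (path j)

  -- The owner is immaterial here: if it is `◇`, totality supplies the required move, and otherwise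
  -- every move will do.
  everywhere⇒forces : ∀ v {T : Vertex → Set} → (∀ u → T u) → OneStepForces G ◇ v T
  everywhere⇒forces v all with 𝒫 v
  ... | ◇ = inj₁ (refl , map₂ (λ e → e , all _) (total v))
  ... | □ = inj₂ ((λ ()) , λ _ → all _)

  anyReply : ∀ pv pw v w → Reply G pv pw v w
  anyReply ◇ ◇ v w = λ _ → total w
  anyReply ◇ □ v w = tt
  anyReply □ ◇ v w = total w , total v
  anyReply □ □ v w = λ _ → total v

  -- If all priorities agree, no obligation ever arises, so that every strategy wins.
  constantPriority⇒simulated : ∀ {p} (δ : Update) → (∀ v → Ω v ≡ p) → δ p p ✓ ≡ ✓ →
    ∀ v w → SimulatedBy G δ v w
  constantPriority⇒simulated {p} δ Ω≡p δ✓ v w =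
    σ , wins {σ}
    where
    σ : DuplicatorStrategy G
    σ _ (v , w , _) = anyReply (𝒫 v) (𝒫 w) v w

    step : ∀ v w → δ (Ω v) (Ω w) ✓ ≡ ✓
    step v w = trans (cong₂ (λ n m → δ n m ✓) (Ω≡p v) (Ω≡p w)) δ✓

    obligation : Position G → Obligation
    obligation (_ , _ , k) = k

    wins : ∀ {σ} ρ → ρ 0 ≡ (v , w , δ (Ω v) (Ω w) ✓) → ConsistentWith G δ σ ρ →
      DuplicatorWins G δ ρ
    wins ρ start consistent n =
      let vₙ , wₙ , _ = ρ n
      in n , ≤-refl , vₙ , wₙ , cong (λ k → vₙ , wₙ , k) (discharged n)
      where
      discharged : ∀ n → obligation (ρ n) ≡ ✓
      discharged zero    = trans (cong obligation start) (step v w)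
      discharged (suc n) = trans (proj₂ (consistent n))
        (trans (cong (δ _ _) (discharged n)) (step _ _))

-- The chain: stuttering bisimilar, but separated by every lockstep relation.

chain : ParityGame
chain = record
  { size  = 3
  ; _•    = λ v → ⁅ next v ⁆
  ; total = λ v → next v , x∈⁅x⁆ (next v)
  ; Ω     = λ { 0F → 0 ; 1F → 0 ; 2F → 1 }
  ; 𝒫     = λ _ → ◇
  }
  where
  next : Fin 3 → Fin 3
  next 0F = 1F
  next 1F = 2F
  next 2F = 2F

module Chain where
  open ParityGame chain

  ⟶-det : ∀ v {w w′} → v ⟶ w → v ⟶ w′ → w ≡ w′
  ⟶-det v e f = trans (x∈⁅y⁆⇒x≡y _ e) (sym (x∈⁅y⁆⇒x≡y _ f))

  step : ∀ {π} → IsPath chain π → ∀ j {v} → π j ≡ v → π (suc j) ≡ proj₁ (total v)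
  step path j refl = x∈⁅y⁆⇒x≡y _ (path j)

  -- The classes are `0F`, `1F` together and `2F` alone.
  _∼_ : Rel Vertex 0ℓ
  v ∼ w = Ω v ≡ Ω w

  twoStepsToSink : ∀ {π} → IsPath chain π → π 2 ≡ 2F
  twoStepsToSink {π} path = at _ refl
    where
    at : ∀ v → π 0 ≡ v → π 2 ≡ 2F
    at 0F eq = step path 1 (step path 0 eq)
    at 1F eq = step path 1 (step path 0 eq)
    at 2F eq = step path 1 (step path 0 eq)

  -- Each vertex starts exactly one path, so the nowhere defined strategy suffices. The sink is
  -- entered after two steps from `0F` and after one from `1F`.
  forcesToSink : ∀ u → u ∼ 2F → ∀ w → w ∼ 1F → ForcesTo chain ◇ (w ∼_) w (u ∼_)
  forcesToSink u u∼2 w w∼1 =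
    record { choice = λ _ → nothing ; owned = λ () ; legal = λ () }
    , λ π path start _ → reach w w∼1 path start
    where
    reach : ∀ w → w ∼ 1F → ∀ {π} → IsPath chain π → π 0 ≡ w →
      ∃[ n ] (u ∼ π n × (∀ j → j < n → w ∼ π j))
    reach 0F _ path eq = 2
      , trans u∼2 (cong Ω (sym (twoStepsToSink path)))
      , λ { zero _ → cong Ω (sym eq)
          ; (suc zero) _ → cong Ω (sym (step path 0 eq))
          ; (suc (suc _)) (s≤s (s≤s ())) }
    reach 1F _ path eq = 1
      , trans u∼2 (cong Ω (sym (step path 0 eq)))
      , λ { zero _ → cong Ω (sym eq) ; (suc _) (s≤s ()) }
    reach 2F () path eq

  cannotStay : ∀ i v → ¬ (v ∼ 2F) → ¬ ForcesWithin chain i (v ∼_) v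
  cannotStay i v v≁2 (σ , stays) =
    let π , path , start , allows = allowedPath chain σ v
    in v≁2 (trans (stays π path start allows 2) (cong Ω (twoStepsToSink path)))

  -- Only the edge from `1F` to `2F` leaves a class; a move from any other vertex contradicts the
  -- assumption that the target class is a different one.
  transfer : ∀ {v w} → v ∼ w → ∀ u → ¬ ((u ∼_) ≐ (v ∼_)) →
    (∃[ v′ ] (v ⟶ v′ × u ∼ v′)) → ForcesTo chain ◇ (w ∼_) w (u ∼_)
  transfer {v} {w} v∼w u differ (v′ , e , u∼v′) =
    leave v v∼w differ (trans u∼v′ (cong Ω (x∈⁅y⁆⇒x≡y _ e)))
    where
    leave : ∀ v → v ∼ w → ¬ ((u ∼_) ≐ (v ∼_)) → u ∼ proj₁ (total v) →
      ForcesTo chain ◇ (w ∼_) w (u ∼_)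
    leave 0F _   differ u∼0 = ⊥-elim (differ (trans (sym u∼0) , trans u∼0))
    leave 1F 1∼w _      u∼2 = forcesToSink u u∼2 w (sym 1∼w)
    leave 2F _   differ u∼2 = ⊥-elim (differ (trans (sym u∼2) , trans u∼2))

  -- No player can stay in the class of `0F` and `1F`, as every path reaches the sink; in the class
  -- of `2F`, both vertices coincide.
  diverge : ∀ {v w} → v ∼ w → ∀ i →
    ForcesWithin chain i (v ∼_) v → ForcesWithin chain i (w ∼_) w
  diverge {0F} {_}  _ i stays = ⊥-elim (cannotStay i 0F (λ ()) stays)
  diverge {1F} {_}  _ i stays = ⊥-elim (cannotStay i 1F (λ ()) stays)
  diverge {2F} {2F} _ i stays = stays

  stutteringBisimilar : StutteringBisimilar chain 0F 1F
  stutteringBisimilar = _∼_ , bisimulation , refl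
    where
    bisimulation : IsStutteringBisimulation chain _∼_
    bisimulation = record
      { isGoverned = record
        { isEquivalence = record { refl = refl ; sym = sym ; trans = trans }
        ; priority = λ v∼w → v∼w
        ; transfer = transfer
        ; diverge = λ {v} {w} → diverge {v} {w}
        }
      ; sameOwner = λ _ → refl
      }

  notGovernedBisimilar : ¬ GovernedBisimilar chain 0F 1F
  notGovernedBisimilar (R , R-bisim , r) = contra (R.transfer r (proj₂ (total 0F)))
    where
    module R = IsGovernedBisimulation R-bisim

    contra : ¬ (∃[ w′ ] (1F ⟶ w′ × R 1F w′))
    contra (w′ , e , r′) with ⟶-det 1F e (proj₂ (total 1F))
    ... | refl with R.priority r′
    ... | ()

  notDirectlySimulated : ∀ {R} → IsDirectSimulation chain R → ¬ R 0F 1F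
  notDirectlySimulated {R} R-sim r = contra (even r refl (proj₂ (total 0F)))
    where
    open IsDirectSimulation R-sim

    contra : ¬ OneStepForces chain ◇ 1F (R 1F)
    contra (inj₁ (_ , w′ , e , r′)) with ⟶-det 1F e (proj₂ (total 1F))
    ... | refl with priority r′
    ... | ()
    contra (inj₂ (≢◇ , _)) = ≢◇ refl

  -- Comparing `1F` with `2F` creates the obligation 0, which the priority pair 1, 1 at the sink
  -- never discharges. The three equations hold for all three updates, so one argument covers them.
  notSimulated : (δ : Update) → δ 0 0 ✓ ≡ ✓ → δ 0 1 ✓ ≡ pending 0 →
    δ 1 1 (pending 0) ≡ pending 0 → ¬ SimulatedBy chain δ 0F 1F
  -- The obligation is `✓` at time 0, so the contradiction is sought from time 1 on.
  notSimulated δ δ00 δ01 δ11 (σ , wins) = lost (wins ρ start consistent 1)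
    where
    ρ : ℕ → Position chain
    ρ 0             = 0F , 1F , ✓
    ρ 1             = 1F , 2F , pending 0
    ρ (suc (suc _)) = 2F , 2F , pending 0

    start : ρ 0 ≡ (0F , 1F , δ 0 0 ✓)
    start = cong (λ k → 0F , 1F , k) (sym δ00)

    -- Duplicator never has a choice of vertex, so any reply agrees with the unique move.
    moves : ∀ v w (r : Successor v → Successor w) →
      ∃[ e ] ∃[ f ] Agrees chain ◇ ◇ r (proj₁ (total v) , e) (proj₁ (total w) , f)
    moves v w r = proj₂ (total v) , proj₂ (total w)
      , ⟶-det w (proj₂ (total w)) (proj₂ (r (total v)))

    reply : ∀ n → let v , w , _ = ρ n in Successor v → Successor w
    reply n = σ (applyDownFrom ρ n) (ρ n)

    consistent : ConsistentWith chain δ σ ρ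
    consistent 0               = moves 0F 1F (reply 0) , sym δ01
    consistent 1               = moves 1F 2F (reply 1) , sym δ11
    consistent n@(suc (suc _)) = moves 2F 2F (reply n) , sym δ11

    lost : ¬ (∃[ m ] (1 ≤ m × (∃[ v ] ∃[ w ] ρ m ≡ (v , w , ✓))))
    lost (suc zero    , _ , _ , _ , ())
    lost (suc (suc _) , _ , _ , _ , ())

-- Two vertices that differ only in their owner.

owners : ParityGame
owners = record
  { size  = 2
  ; _•    = λ _ → ⁅ 0F ⁆
  ; total = λ _ → 0F , x∈⁅x⁆ 0F
  ; Ω     = λ _ → 0
  ; 𝒫     = λ { 0F → ◇ ; 1F → □ }
  }

module Owners where
  open ParityGame owners

  notStutteringBisimilar : ¬ StutteringBisimilar owners 0F 1F
  notStutteringBisimilar (_ , R-bisim , r)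
    with IsStutteringBisimulation.sameOwner R-bisim r
  ... | ()

  governedBisimilar : GovernedBisimilar owners 0F 1F
  governedBisimilar = (λ _ _ → ⊤) , bisimulation , tt
    where
    bisimulation : IsGovernedBisimulation owners (λ _ _ → ⊤)
    bisimulation = record
      { symmetric = λ _ → tt
      ; priority  = λ _ → refl
      ; mixed     = λ _ _ _ _ → tt
      -- Both vertices have the same successors, so a move is answered by itself.
      ; transfer  = λ _ e → _ , e , tt
      }

  directSimulationEquivalent : DirectSimulationEquivalent owners 0F 1F
  directSimulationEquivalent = ((λ _ _ → ⊤) , simulation , tt) , ((λ _ _ → ⊤) , simulation , tt)
    where
    simulation : IsDirectSimulation owners (λ _ _ → ⊤)
    simulation = record
      { priority = λ _ → refl
      ; even     = λ {_} {w} _ _ _ → everywhere⇒forces owners w λ _ → tt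
      ; odd      = λ {v} {w} _ _ → everywhere⇒forces owners w λ _ → 0F , proj₂ (total v) , tt
      }

  simulationEquivalent : ∀ δ → δ 0 0 ✓ ≡ ✓ → SimulationEquivalent owners δ 0F 1F
  simulationEquivalent δ δ✓ = sim 0F 1F , sim 1F 0F
    where sim = constantPriority⇒simulated owners δ (λ _ → refl) δ✓

-- Strong direct simulation equivalence without stuttering bisimilarity.

extraMove : ParityGame
extraMove = record
  { size  = 4
  ; _•    = succs
  ; total = λ { 0F → 0F , here ; 1F → 0F , here ; 2F → 2F , there (there here)
              ; 3F → 3F , there (there (there here)) }
  ; Ω     = λ { 0F → 0 ; 1F → 0 ; 2F → 0 ; 3F → 1 }
  ; 𝒫     = λ _ → ◇
  }
  where
  succs : Fin 4 → Subset 4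
  succs 0F = inside  ∷ outside ∷ outside ∷ inside  ∷ []
  succs 1F = inside  ∷ outside ∷ inside  ∷ inside  ∷ []
  succs 2F = outside ∷ outside ∷ inside  ∷ outside ∷ []
  succs 3F = outside ∷ outside ∷ outside ∷ inside  ∷ []

module ExtraMove where
  open ParityGame extraMove

  -- The extra move from `1F` to `2F` is answered by the loop at `0F`, which calls for `2⊑0`. The
  -- converse of `2⊑0` would fail, since `0F` can move to `3F` and `2F` cannot match that.
  data _⊑_ : Rel Vertex 0ℓ where
    ⊑-refl : ∀ {v} → v ⊑ v
    0⊑1    : 0F ⊑ 1F
    1⊑0    : 1F ⊑ 0F
    2⊑0    : 2F ⊑ 0F

  strongDirectSimulationEquivalent : StrongDirectSimulationEquivalent extraMove 0F 1F
  strongDirectSimulationEquivalent = (_⊑_ , simulation , 0⊑1) , (_⊑_ , simulation , 1⊑0)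
    where
    priority : ∀ {v w} → v ⊑ w → Ω v ≡ Ω w
    priority ⊑-refl = refl
    priority 0⊑1    = refl
    priority 1⊑0    = refl
    priority 2⊑0    = refl

    match : ∀ {v w} → v ⊑ w → ∀ {v′} → v ⟶ v′ → ∃[ w′ ] (w ⟶ w′ × v′ ⊑ w′)
    match ⊑-refl e                            = _ , e , ⊑-refl
    match 0⊑1    here                         = 0F , here , ⊑-refl
    match 0⊑1    (there (there (there here))) = 3F , there (there (there here)) , ⊑-refl
    match 1⊑0    here                         = 0F , here , ⊑-refl
    match 1⊑0    (there (there here))         = 0F , here , 2⊑0
    match 1⊑0    (there (there (there here))) = 3F , there (there (there here)) , ⊑-refl
    match 2⊑0    (there (there here))         = 0F , here , 2⊑0
    match 2⊑0    (there (there (there (there ()))))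

    simulation : IsStrongDirectSimulation extraMove _⊑_
    simulation = record
      { isDirect = record
        { priority = priority
        ; even     = λ v⊑w _ e → inj₁ (refl , match v⊑w e)
        ; odd      = λ _ ()
        }
      ; sameOwner = λ _ → refl
      }

  notStutteringBisimilar : ¬ StutteringBisimilar extraMove 0F 1F
  -- The move from `1F` to `2F` would oblige `0F` to force a visit to the class of `2F`. That class
  -- is not the class of `1F`, because `1F` can move to `3F`.
  notStutteringBisimilar (R , R-bisim , r) = 0-cannotReach-2 (transfer 1R0 2F
      (λ (_ , R1⊆R2) → 2-notRelated 1F (there (there (there here))) (R1⊆R2 R-refl))
      (2F , there (there here) , R-refl))
    where
    open IsStutteringBisimulation R-bisim
    open IsGovernedStutteringBisimulation isGoverned
    open IsEquivalence isEquivalence renaming (refl to R-refl; sym to R-sym)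

    1R0 : R 1F 0F
    1R0 = R-sym r

    priorities-differ : ∀ {v w} → ¬ (Ω v ≡ Ω w) → ¬ R v w
    priorities-differ differ r = differ (priority r)

    2-closed : ∀ {u u′} → 2F ≡ u → u ⟶ u′ → 2F ≡ u′
    2-closed refl (there (there here)) = refl
    2-closed refl (there (there (there (there ()))))

    -- Every path from `2F` stays there, and `2F` and `3F` have different priorities.
    2-cannotReach-3 : ¬ ForcesTo extraMove ◇ (R 2F) 2F (R 3F)
    2-cannotReach-3 (σ , forces) =
      let π , path , start , allows = allowedPath extraMove σ 2F
          n , R3πn , _              = forces π path start allows
          2≡πn = path-invariant extraMove (2F ≡_) 2-closed path (sym start) n
      in priorities-differ (λ ()) (subst (R 3F) (sym 2≡πn) R3πn)

    -- Transferring the move to `3F` would make `2F` reach the class of `3F`. If that class were the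
    -- class of `u`, it would contain `2F`, against the priorities.
    2-notRelated : ∀ u → u ⟶ 3F → ¬ R 2F u
    2-notRelated u e R2u = 2-cannotReach-3 (transfer (R-sym R2u) 3F
      (λ (_ , Ru⊆R3) → priorities-differ (λ ()) (Ru⊆R3 (R-sym R2u)))
      (3F , e , R-refl))

    successorsOf0-closed : ∀ {u u′} → 0F ⟶ u → u ⟶ u′ → 0F ⟶ u′
    successorsOf0-closed here e = e
    successorsOf0-closed 0⟶3@(there (there (there here))) (there (there (there here))) = 0⟶3

    successorsOf0⟶3 : ∀ {u} → 0F ⟶ u → u ⟶ 3F
    successorsOf0⟶3 here                         = there (there (there here))
    successorsOf0⟶3 (there (there (there here))) = there (there (there here))

    -- Paths from `0F` stay among its successors `0F` and `3F`. Both can move to `3F`, so by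
    -- `2-notRelated` neither lies in the class of `2F`.
    0-cannotReach-2 : ¬ ForcesTo extraMove ◇ (R 0F) 0F (R 2F)
    0-cannotReach-2 (σ , forces) =
      let π , path , start , allows = allowedPath extraMove σ 0F
          n , R2πn , _              = forces π path start allows
          0⟶πn = path-invariant extraMove (0F ⟶_) successorsOf0-closed path
            -- The loop at `0F` makes the invariant hold at the start.
            (subst (0F ⟶_) (sym start) here) n
      in 2-notRelated (π n) (successorsOf0⟶3 0⟶πn) R2πn

-- Assembling the six incomparabilities from the three games.

theorem25 : Incomparable StutteringBisimilar GovernedBisimilar
    × Incomparable StutteringBisimilar StrongDirectSimulationEquivalent
    × Incomparable StutteringBisimilar DirectSimulationEquivalent
    × Incomparable StutteringBisimilar DelayedSimulationEquivalent
    × Incomparable StutteringBisimilar EvenBiasedDelayedSimulationEquivalent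
    × Incomparable StutteringBisimilar OddBiasedDelayedSimulationEquivalent
theorem25 =
    ( stuttering⊈ GovernedBisimilar notGovernedBisimilar
    , ⊈stuttering GovernedBisimilar governedBisimilar )
  , ( stuttering⊈ StrongDirectSimulationEquivalent
        (λ ((_ , R-sim , r) , _) → notDirectlySimulated (isDirect R-sim) r)
    , extraMove , 0F , 1F , strongDirectSimulationEquivalent , ExtraMove.notStutteringBisimilar )
  , ( stuttering⊈ DirectSimulationEquivalent (λ ((_ , R-sim , r) , _) → notDirectlySimulated R-sim r)
    , ⊈stuttering DirectSimulationEquivalent directSimulationEquivalent )
  , ( stuttering⊈ DelayedSimulationEquivalent (λ (sim , _) → notSimulated γ refl refl refl sim)
    , ⊈stuttering DelayedSimulationEquivalent (simulationEquivalent γ refl) )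
  , ( stuttering⊈ EvenBiasedDelayedSimulationEquivalent
        (λ (sim , _) → notSimulated γᵉ refl refl refl sim)
    , ⊈stuttering EvenBiasedDelayedSimulationEquivalent (simulationEquivalent γᵉ refl) )
  , ( stuttering⊈ OddBiasedDelayedSimulationEquivalent
        (λ (sim , _) → notSimulated γᵒ refl refl refl sim)
    , ⊈stuttering OddBiasedDelayedSimulationEquivalent (simulationEquivalent γᵒ refl) )
  where
  open Chain
  open Owners
  open ExtraMove using (strongDirectSimulationEquivalent)
  open IsStrongDirectSimulation using (isDirect)

  stuttering⊈ : ∀ {a} (_≈_ : GameRel a) → ¬ _≈_ chain 0F 1F →
    ∃[ G ] ∃[ v ] ∃[ w ] (StutteringBisimilar G v w × ¬ _≈_ G v w)
  stuttering⊈ _ 0≉1 = chain , 0F , 1F , stutteringBisimilar , 0≉1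

  ⊈stuttering : ∀ {a} (_≈_ : GameRel a) → _≈_ owners 0F 1F →
    ∃[ G ] ∃[ v ] ∃[ w ] (_≈_ G v w × ¬ StutteringBisimilar G v w)
  ⊈stuttering _ 0≈1 = owners , 0F , 1F , 0≈1 , notStutteringBisimilar
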